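{- Let $S$ be an $n$-element set and let $\mathcal{A},\mathcal{B}$ be families of subsets of $S$ such that $(\mathcal{A},\mathcal{B})$ is a cancellative pair. Then $|\mathcal{A}||\mathcal{B}|\leq 2.2682^n$.
   Context: A pair $(\mathcal{A},\mathcal{B})$ of families of subsets of a finite set $S$ is called cancellative if (i) whenever $A,A'\in\mathcal{A}$ and $B\in\mathcal{B}$ satisfy $A\cup B=A'\cup B$, then $A=A'$; and (ii) whenever $A\in\mathcal{A}$ and $B,B'\in\mathcal{B}$ satisfy $A\cup B=A\cup B'$, then $B=B'$. -}

module Defs where

open import Data.Nat using (ℕ)
open import Data.List using (List)
open import Data.List.Membership.Propositional using (_∈_)
open import Data.Fin.Subset using (Subset; _∪_)
open import Relation.Binary.PropositionalEquality using (_≡_)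

-- A family of subsets of S = Fin n is a duplicate-free list of subsets
-- (duplicate-freeness is imposed in the statement via Unique).
Family : ℕ → Set
Family n = List (Subset n)

Cancellative : ∀ {n} → Family n → Family n → Set
Cancellative {n} 𝒜 ℬ =
  (∀ {A A′ B} → A ∈ 𝒜 → A′ ∈ 𝒜 → B ∈ ℬ → A ∪ B ≡ A′ ∪ B → A ≡ A′)
  × (∀ {A B B′} → A ∈ 𝒜 → B ∈ ℬ → B′ ∈ ℬ → A ∪ B ≡ A ∪ B′ → B ≡ B′)
  where open import Data.Product using (_×_)

{-# OPTIONS --safe #-}
module Submission where

-- The stronger bound |𝒜||ℬ| ≤ (9/4)ⁿ holds.  For α ∈ [0,1]ⁿ put f(A) = ∏_{i∉A} αᵢ and g(B) = ∏_{i∉B} (1 − αᵢ).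
-- Then f(A) g(B) = P(A ∖ B) Q(B ∖ A), where P and Q are the probabilities of these sets when the elements
-- outside B, respectively outside A, are drawn independently with probability 1 − αᵢ, respectively αᵢ.
-- Cancellation makes A ↦ A ∖ B injective for each B, so P sums to at most 1 over 𝒜, and likewise Q over ℬ;
-- Cauchy–Schwarz then gives Σ f · Σ g ≤ 1.  Coordinates are now given weight 1 in place of α, one at a time, each
-- at the cost of a factor 9/4.  Splitting the two total weights by that coordinate into a₀, a₁ and b₀, b₁, the
-- sets avoiding it form a cancellative pair on fewer points, so a₀b₀ ≤ 1 (in normalised form), while
-- (αa₀ + a₁)((1 − α)b₀ + b₁) ≤ 1 for every α.  When the α equalising the normalised factors α + a₁/a₀ and
-- 1 − α + b₁/b₀ lies in [0,1], it gives √(a₀b₀) (1 + a₁/a₀ + b₁/b₀) ≤ 2, and hence by AM–GM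
-- √((a₀ + a₁)(b₀ + b₁)) ≤ √(a₀b₀) (1 + (a₁/a₀ + b₁/b₀)/2) ≤ 3/2.

open import Defs
open import Data.Nat using (ℕ; zero; suc; _+_; _*_; _^_; _≤_; _<_; _∸_; z≤n; s≤s; NonZero; >-nonZero)
open import Data.Nat.Properties
open import Data.Nat.Tactic.RingSolver using (solve-∀)
open import Data.Bool using (Bool; true; false; _∨_)
open import Data.Bool.Properties using () renaming (_≟_ to _≟ᵇ_)
open import Data.Fin.Subset using (Subset; _∪_; inside; outside)
open import Data.Fin.Subset.Properties using (∪-comm)
open import Data.List using ([]; _∷_; length)
open import Data.List.Membership.Propositional using (_∈_)
open import Data.List.Relation.Unary.All as All using ()
open import Data.List.Relation.Unary.AllPairs using ([]; _∷_)
open import Data.List.Relation.Unary.Any using (here; there)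
open import Data.List.Relation.Unary.Unique.Propositional using (Unique)
open import Data.Product using (_×_; _,_; ∃; proj₂)
open import Data.Sum using (inj₁; inj₂)
open import Data.Vec using (Vec; []; _∷_)
open import Data.Vec.Properties using (∷-injectiveˡ; ∷-injectiveʳ; ≡-dec)
open import Relation.Binary.PropositionalEquality
  using (_≡_; refl; sym; trans; cong; cong₂; subst; subst₂; module ≡-Reasoning)
open import Relation.Nullary using (yes; no; does; contradiction)
open import Relation.Nullary.Decidable using (dec-true; dec-false)

-- Sums over all subsets of a finite set.

Σ⟨_⟩ : ∀ n → (Subset n → ℕ) → ℕ
Σ⟨ zero  ⟩ f = f []
Σ⟨ suc n ⟩ f = Σ⟨ n ⟩ (λ A → f (outside ∷ A)) + Σ⟨ n ⟩ (λ A → f (inside ∷ A))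

Σ-cong : ∀ n {f g : Subset n → ℕ} → (∀ A → f A ≡ g A) → Σ⟨ n ⟩ f ≡ Σ⟨ n ⟩ g
Σ-cong zero    f≡g = f≡g []
Σ-cong (suc n) f≡g = cong₂ _+_ (Σ-cong n (λ A → f≡g (_ ∷ A))) (Σ-cong n (λ A → f≡g (_ ∷ A)))

Σ-mono : ∀ n {f g : Subset n → ℕ} → (∀ A → f A ≤ g A) → Σ⟨ n ⟩ f ≤ Σ⟨ n ⟩ g
Σ-mono zero    f≤g = f≤g []
Σ-mono (suc n) f≤g = +-mono-≤ (Σ-mono n (λ A → f≤g (_ ∷ A))) (Σ-mono n (λ A → f≤g (_ ∷ A)))

interchange : ∀ a b c d → (a + b) + (c + d) ≡ (a + c) + (b + d)
interchange = solve-∀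

Σ-+ : ∀ n (f g : Subset n → ℕ) → Σ⟨ n ⟩ (λ A → f A + g A) ≡ Σ⟨ n ⟩ f + Σ⟨ n ⟩ g
Σ-+ zero    f g = refl
Σ-+ (suc n) f g =
  trans (cong₂ _+_ (Σ-+ n _ _) (Σ-+ n _ _))
        (interchange (Σ⟨ n ⟩ (λ A → f (outside ∷ A))) _ _ _)

Σ-*ˡ : ∀ n c (f : Subset n → ℕ) → Σ⟨ n ⟩ (λ A → c * f A) ≡ c * Σ⟨ n ⟩ f
Σ-*ˡ zero    c f = refl
Σ-*ˡ (suc n) c f =
  trans (cong₂ _+_ (Σ-*ˡ n c _) (Σ-*ˡ n c _))
        (sym (*-distribˡ-+ c (Σ⟨ n ⟩ (λ A → f (outside ∷ A))) _))

Σ-*ʳ : ∀ n c (f : Subset n → ℕ) → Σ⟨ n ⟩ (λ A → f A * c) ≡ Σ⟨ n ⟩ f * c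
Σ-*ʳ n c f =
  trans (Σ-cong n (λ A → *-comm (f A) c)) (trans (Σ-*ˡ n c f) (*-comm c (Σ⟨ n ⟩ f)))

Σ-swap : ∀ m n (f : Subset m → Subset n → ℕ) →
  Σ⟨ m ⟩ (λ A → Σ⟨ n ⟩ (f A)) ≡ Σ⟨ n ⟩ (λ B → Σ⟨ m ⟩ (λ A → f A B))
Σ-swap zero    n f = refl
Σ-swap (suc m) n f =
  trans (cong₂ _+_ (Σ-swap m n _) (Σ-swap m n _)) (sym (Σ-+ n _ _))

-- AM-GM and Cauchy-Schwarz over the natural numbers.

m²≤n²⇒m≤n : ∀ {m n} → m * m ≤ n * n → m ≤ n
m²≤n²⇒m≤n {m} {n} m²≤n² with m ≤? n
... | yes m≤n = m≤n
... | no  m≰n = contradiction m²≤n² (<⇒≱ (*-mono-< (≰⇒> m≰n) (≰⇒> m≰n)))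

2mn≤m²+n² : ∀ m n → 2 * (m * n) ≤ m * m + n * n
2mn≤m²+n² m n with ≤-total m n
-- With the larger number written as the smaller plus `d`, the two sides differ by d².
... | inj₁ m≤n with d , refl ← m≤n⇒∃[o]m+o≡n m≤n = ≤-trans (m≤m+n _ (d * d)) (≤-reflexive (expand m d))
  where
  expand : ∀ x d → 2 * (x * (x + d)) + d * d ≡ x * x + (x + d) * (x + d)
  expand = solve-∀
... | inj₂ n≤m with d , refl ← m≤n⇒∃[o]m+o≡n n≤m = ≤-trans (m≤m+n _ (d * d)) (≤-reflexive (expand n d))
  where
  expand : ∀ x d → 2 * ((x + d) * x) + d * d ≡ (x + d) * (x + d) + x * x
  expand = solve-∀

4mn≤[m+n]² : ∀ m n → 4 * (m * n) ≤ (m + n) * (m + n)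
4mn≤[m+n]² m n = begin
  4 * (m * n)                     ≡⟨ split m n ⟩
  2 * (m * n) + 2 * (m * n)       ≤⟨ +-monoˡ-≤ (2 * (m * n)) (2mn≤m²+n² m n) ⟩
  (m * m + n * n) + 2 * (m * n)   ≡⟨ square m n ⟩
  (m + n) * (m + n)               ∎
  where
  open ≤-Reasoning
  split : ∀ m n → 4 * (m * n) ≡ 2 * (m * n) + 2 * (m * n)
  split = solve-∀
  square : ∀ m n → (m * m + n * n) + 2 * (m * n) ≡ (m + n) * (m + n)
  square = solve-∀

-- The cross terms are compared through their squares, where `h₁` and `h₂` multiply to z₁²z₂² ≤
-- (x₁y₂)(x₂y₁) and AM-GM applies; this keeps the argument within ℕ.
cauchy-schwarz₂ : ∀ x₁ x₂ y₁ y₂ z₁ z₂ → z₁ * z₁ ≤ x₁ * y₁ → z₂ * z₂ ≤ x₂ * y₂ →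
  (z₁ + z₂) * (z₁ + z₂) ≤ (x₁ + x₂) * (y₁ + y₂)
cauchy-schwarz₂ x₁ x₂ y₁ y₂ z₁ z₂ h₁ h₂ = begin
  (z₁ + z₂) * (z₁ + z₂)                       ≡⟨ square z₁ z₂ ⟩
  (z₁ * z₁ + z₂ * z₂) + 2 * (z₁ * z₂)         ≤⟨ +-mono-≤ (+-mono-≤ h₁ h₂) (m²≤n²⇒m≤n cross²) ⟩
  (x₁ * y₁ + x₂ * y₂) + (x₁ * y₂ + x₂ * y₁)   ≡⟨ expand x₁ x₂ y₁ y₂ ⟩
  (x₁ + x₂) * (y₁ + y₂)                       ∎
  where
  open ≤-Reasoning
  square : ∀ a b → (a + b) * (a + b) ≡ (a * a + b * b) + 2 * (a * b)
  square = solve-∀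
  expand : ∀ a b c d → (a * c + b * d) + (a * d + b * c) ≡ (a + b) * (c + d)
  expand = solve-∀
  regroup : ∀ a b → 2 * (a * b) * (2 * (a * b)) ≡ 4 * ((a * a) * (b * b))
  regroup = solve-∀
  exchange : ∀ a b c d → 4 * ((a * c) * (b * d)) ≡ 4 * ((a * d) * (b * c))
  exchange = solve-∀
  cross² : 2 * (z₁ * z₂) * (2 * (z₁ * z₂)) ≤ (x₁ * y₂ + x₂ * y₁) * (x₁ * y₂ + x₂ * y₁)
  cross² = begin
    2 * (z₁ * z₂) * (2 * (z₁ * z₂))               ≡⟨ regroup z₁ z₂ ⟩
    4 * ((z₁ * z₁) * (z₂ * z₂))                   ≤⟨ *-monoʳ-≤ 4 (*-mono-≤ h₁ h₂) ⟩
    4 * ((x₁ * y₁) * (x₂ * y₂))                   ≡⟨ exchange x₁ x₂ y₁ y₂ ⟩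
    4 * ((x₁ * y₂) * (x₂ * y₁))                   ≤⟨ 4mn≤[m+n]² (x₁ * y₂) (x₂ * y₁) ⟩
    (x₁ * y₂ + x₂ * y₁) * (x₁ * y₂ + x₂ * y₁)     ∎

-- The conclusion has the shape of the hypothesis, which drives the induction and later lets the
-- inequality be nested for double sums.
cauchy-schwarz : ∀ n {x y z : Subset n → ℕ} → (∀ A → z A * z A ≤ x A * y A) →
  Σ⟨ n ⟩ z * Σ⟨ n ⟩ z ≤ Σ⟨ n ⟩ x * Σ⟨ n ⟩ y
cauchy-schwarz zero    z²≤xy = z²≤xy []
cauchy-schwarz (suc n) {x} {y} {z} z²≤xy =
  cauchy-schwarz₂ (Σ⟨ n ⟩ (λ A → x (outside ∷ A))) (Σ⟨ n ⟩ (λ A → x (inside ∷ A)))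
                  (Σ⟨ n ⟩ (λ A → y (outside ∷ A))) (Σ⟨ n ⟩ (λ A → y (inside ∷ A)))
                  (Σ⟨ n ⟩ (λ A → z (outside ∷ A))) (Σ⟨ n ⟩ (λ A → z (inside ∷ A)))
    (cauchy-schwarz n (λ A → z²≤xy (outside ∷ A)))
    (cauchy-schwarz n (λ A → z²≤xy (inside ∷ A)))

-- Weights, kernels and the weighted inequality.

⟦_⟧ : Bool → ℕ
⟦ false ⟧ = 0
⟦ true  ⟧ = 1

-- An entry (k , l) encodes the parameter α = k / (k + l) of a coordinate, cleared of its denominator.
Weights : ℕ → Set
Weights r = Vec (ℕ × ℕ) r

-- Exchanges α and 1 - α, the parameters of the two families.
dual : ∀ {r} → Weights r → Weights r
dual []            = []
dual ((k , l) ∷ c) = (l , k) ∷ dual c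

-- The common denominator: divided by it, `weight` becomes f and `kernel` a probability.
mass : ∀ {r} → Weights r → ℕ
mass []            = 1
mass ((k , l) ∷ c) = (k + l) * mass c

mass-dual : ∀ {r} (c : Weights r) → mass (dual c) ≡ mass c
mass-dual []            = refl
mass-dual ((k , l) ∷ c) = cong₂ _*_ (+-comm l k) (mass-dual c)

weight : ∀ {r} → Weights r → Subset r → ℕ
weight []            []            = 1
weight ((k , l) ∷ c) (outside ∷ A) = k * weight c A
weight ((k , l) ∷ c) (inside  ∷ A) = (k + l) * weight c A

-- Up to scaling, the probability of A ∖ B when each element outside B is drawn with probability l / (k + l).
kernel : ∀ {r} → Weights r → Subset r → Subset r → ℕ
kernel []            []            []            = 1
kernel ((k , l) ∷ c) (a ∷ A)       (inside  ∷ B) = (k + l) * kernel c A B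
kernel ((k , l) ∷ c) (outside ∷ A) (outside ∷ B) = k * kernel c A B
kernel ((k , l) ∷ c) (inside  ∷ A) (outside ∷ B) = l * kernel c A B

*-interchange : ∀ a b c d → (a * b) * (c * d) ≡ (a * c) * (b * d)
*-interchange = solve-∀

-- Where exactly one of the two sets contains a point, the factor `k` or `l` passes from the weight
-- of the set omitting it to the kernel of the other set.
weight-factors : ∀ {r} (c : Weights r) A B →
  weight c A * weight (dual c) B ≡ kernel c A B * kernel (dual c) B A
weight-factors [] [] [] = refl
weight-factors ((k , l) ∷ c) (a ∷ A) (b ∷ B) = go a b
  where
  open ≡-Reasoning
  push : ∀ x y x′ y′ → x * y ≡ x′ * y′ →
    (x * weight c A) * (y * weight (dual c) B) ≡ (x′ * kernel c A B) * (y′ * kernel (dual c) B A)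
  push x y x′ y′ eq = begin
    (x * weight c A) * (y * weight (dual c) B)          ≡⟨ *-interchange x _ y _ ⟩
    (x * y) * (weight c A * weight (dual c) B)          ≡⟨ cong₂ _*_ eq (weight-factors c A B) ⟩
    (x′ * y′) * (kernel c A B * kernel (dual c) B A)    ≡⟨ *-interchange x′ y′ _ _ ⟩
    (x′ * kernel c A B) * (y′ * kernel (dual c) B A)    ∎
  go : ∀ a b → weight ((k , l) ∷ c) (a ∷ A) * weight (dual ((k , l) ∷ c)) (b ∷ B)
             ≡ kernel ((k , l) ∷ c) (a ∷ A) (b ∷ B) * kernel (dual ((k , l) ∷ c)) (b ∷ B) (a ∷ A)
  go false false = push k l k l refl
  go false true  = push k (l + k) (k + l) k (trans (*-comm k (l + k)) (cong (_* k) (+-comm l k)))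
  go true  false = push (k + l) l l (l + k) (trans (*-comm (k + l) l) (cong (l *_) (+-comm k l)))
  go true  true  = push (k + l) (l + k) (k + l) (l + k) refl

-- Here `φ` is the indicator of a family. Equal unions with B amount to equal differences, so this
-- is injectivity of A ↦ A ∖ B.
InjectiveOver : ∀ {r} → Subset r → (Subset r → Bool) → Set
InjectiveOver B φ = ∀ {A A′} → φ A ≡ true → φ A′ ≡ true → A ∪ B ≡ A′ ∪ B → A ≡ A′

-- Distinct members have distinct differences A ∖ B, hence disjoint events of total probability at
-- most 1. A coordinate outside B splits the sum with ratio k : l; at one inside B the two slices
-- are disjoint and merge into one family.
kernel-sum : ∀ {r} (c : Weights r) φ B → InjectiveOver B φ →
  Σ⟨ r ⟩ (λ A → ⟦ φ A ⟧ * kernel c A B) ≤ mass c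
kernel-sum [] φ [] inj with φ []
... | false = z≤n
... | true  = ≤-refl
kernel-sum {suc r} ((k , l) ∷ c) φ (outside ∷ B) inj = begin
  Σ⟨ r ⟩ (λ A → ⟦ φ (outside ∷ A) ⟧ * (k * kernel c A B)) + Σ⟨ r ⟩ (λ A → ⟦ φ (inside ∷ A) ⟧ * (l * kernel c A B))
    ≡⟨ cong₂ _+_ (pull k outside) (pull l inside) ⟩
  k * Σ⟨ r ⟩ (λ A → ⟦ φ (outside ∷ A) ⟧ * kernel c A B) + l * Σ⟨ r ⟩ (λ A → ⟦ φ (inside ∷ A) ⟧ * kernel c A B)
    ≤⟨ +-mono-≤ (*-monoʳ-≤ k (bound outside)) (*-monoʳ-≤ l (bound inside)) ⟩
  k * mass c + l * mass c
    ≡⟨ *-distribʳ-+ (mass c) k l ⟨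
  (k + l) * mass c ∎
  where
  open ≤-Reasoning
  comm : ∀ a b d → a * (b * d) ≡ b * (a * d)
  comm = solve-∀
  pull : ∀ x a → Σ⟨ r ⟩ (λ A → ⟦ φ (a ∷ A) ⟧ * (x * kernel c A B)) ≡ x * Σ⟨ r ⟩ (λ A → ⟦ φ (a ∷ A) ⟧ * kernel c A B)
  pull x a = trans (Σ-cong r (λ A → comm ⟦ φ (a ∷ A) ⟧ x _)) (Σ-*ˡ r x _)
  bound : ∀ a → Σ⟨ r ⟩ (λ A → ⟦ φ (a ∷ A) ⟧ * kernel c A B) ≤ mass c
  bound a = kernel-sum c (λ A → φ (a ∷ A)) B
    (λ h h′ eq → ∷-injectiveʳ (inj h h′ (cong ((a ∨ false) ∷_) eq)))
kernel-sum {suc r} ((k , l) ∷ c) φ (inside ∷ B) inj = begin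
  Σ⟨ r ⟩ (λ A → ⟦ φ (outside ∷ A) ⟧ * ((k + l) * kernel c A B)) + Σ⟨ r ⟩ (λ A → ⟦ φ (inside ∷ A) ⟧ * ((k + l) * kernel c A B))
    ≡⟨ Σ-+ r _ _ ⟨
  Σ⟨ r ⟩ (λ A → ⟦ φ (outside ∷ A) ⟧ * ((k + l) * kernel c A B) + ⟦ φ (inside ∷ A) ⟧ * ((k + l) * kernel c A B))
    ≡⟨ Σ-cong r merge ⟩
  Σ⟨ r ⟩ (λ A → (k + l) * (⟦ φ (outside ∷ A) ∨ φ (inside ∷ A) ⟧ * kernel c A B))
    ≡⟨ Σ-*ˡ r (k + l) _ ⟩
  (k + l) * Σ⟨ r ⟩ (λ A → ⟦ φ (outside ∷ A) ∨ φ (inside ∷ A) ⟧ * kernel c A B)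
    ≤⟨ *-monoʳ-≤ (k + l) (kernel-sum c _ B inj′) ⟩
  (k + l) * mass c ∎
  where
  open ≤-Reasoning
  merge : ∀ A → ⟦ φ (outside ∷ A) ⟧ * ((k + l) * kernel c A B) + ⟦ φ (inside ∷ A) ⟧ * ((k + l) * kernel c A B)
              ≡ (k + l) * (⟦ φ (outside ∷ A) ∨ φ (inside ∷ A) ⟧ * kernel c A B)
  merge A with φ (outside ∷ A) in eq₀ | φ (inside ∷ A) in eq₁
  ... | false | false = sym (*-zeroʳ (k + l))
  ... | false | true  = trans (*-identityˡ _) (cong ((k + l) *_) (sym (*-identityˡ _)))
  ... | true  | false = trans (+-identityʳ _) (trans (*-identityˡ _) (cong ((k + l) *_) (sym (*-identityˡ _))))
  -- Both sets have the same union with `inside ∷ B`, so injectivity would identify them despite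
  -- their different first entries.
  ... | true  | true  = contradiction (inj eq₀ eq₁ refl) λ ()
  some : ∀ {A} → φ (outside ∷ A) ∨ φ (inside ∷ A) ≡ true → ∃ λ a → φ (a ∷ A) ≡ true
  some {A} h with φ (outside ∷ A) in eq
  ... | true  = outside , eq
  ... | false = inside , h
  ∨-inside : ∀ a → a ∨ inside ≡ inside
  ∨-inside false = refl
  ∨-inside true  = refl
  inj′ : InjectiveOver B (λ A → φ (outside ∷ A) ∨ φ (inside ∷ A))
  inj′ h h′ eq with some h | some h′
  ... | a , e | a′ , e′ =
    ∷-injectiveʳ (inj e e′ (cong₂ _∷_ (trans (∨-inside a) (sym (∨-inside a′))) eq))

-- Cauchy-Schwarz over pairs (A, B): `kernel-sum` controls the column sums of `x` and the row sums
-- of `y`, so (ab)² ≤ (Kb)(Ka), and ab cancels.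
weighted-bound : ∀ {r} (c : Weights r) (φ ψ : Subset r → Bool) →
  (∀ {B} → ψ B ≡ true → InjectiveOver B φ) → (∀ {A} → φ A ≡ true → InjectiveOver A ψ) →
  Σ⟨ r ⟩ (λ A → ⟦ φ A ⟧ * weight c A) * Σ⟨ r ⟩ (λ B → ⟦ ψ B ⟧ * weight (dual c) B) ≤ mass c * mass c
weighted-bound {r} c φ ψ injφ injψ = cancel (a * b) refl
  where
  open ≤-Reasoning
  K = mass c
  f g : Subset r → ℕ
  f A = ⟦ φ A ⟧ * weight c A
  g B = ⟦ ψ B ⟧ * weight (dual c) B
  a = Σ⟨ r ⟩ f
  b = Σ⟨ r ⟩ g
  x y z : Subset r → Subset r → ℕ
  x A B = ⟦ φ A ⟧ * kernel c A B * g B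
  y A B = ⟦ ψ B ⟧ * kernel (dual c) B A * f A
  z A B = f A * g B

  z²≤xy : ∀ A B → z A B * z A B ≤ x A B * y A B
  z²≤xy A B = ≤-reflexive (begin-equality
    z A B * z A B
      ≡⟨ lhs ⟦ φ A ⟧ ⟦ ψ B ⟧ (weight c A) (weight (dual c) B) ⟩
    q * (weight c A * weight (dual c) B)
      ≡⟨ cong (q *_) (weight-factors c A B) ⟩
    q * (kernel c A B * kernel (dual c) B A)
      ≡⟨ rhs ⟦ φ A ⟧ ⟦ ψ B ⟧ (weight c A) (weight (dual c) B) (kernel c A B) (kernel (dual c) B A) ⟩
    x A B * y A B ∎)
    where
    -- One copy of the weight product stays in `q`; only the other is turned into kernels, so that
    -- `x` keeps a factor `g` and `y` a factor `f`.
    q = ⟦ φ A ⟧ * ⟦ ψ B ⟧ * (⟦ φ A ⟧ * ⟦ ψ B ⟧) * (weight c A * weight (dual c) B)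
    lhs : ∀ p q u v → p * u * (q * v) * (p * u * (q * v)) ≡ p * q * (p * q) * (u * v) * (u * v)
    lhs = solve-∀
    rhs : ∀ p q u v m n → p * q * (p * q) * (u * v) * (m * n) ≡ p * m * (q * v) * (q * n * (p * u))
    rhs = solve-∀

  Σz : Σ⟨ r ⟩ (λ A → Σ⟨ r ⟩ (z A)) ≡ a * b
  Σz = trans (Σ-cong r (λ A → Σ-*ˡ r (f A) g)) (Σ-*ʳ r b f)

  Σx≤ : Σ⟨ r ⟩ (λ A → Σ⟨ r ⟩ (x A)) ≤ K * b
  Σx≤ = begin
    Σ⟨ r ⟩ (λ A → Σ⟨ r ⟩ (x A))                                ≡⟨ Σ-swap r r x ⟩
    Σ⟨ r ⟩ (λ B → Σ⟨ r ⟩ (λ A → x A B))                        ≡⟨ Σ-cong r (λ B → Σ-*ʳ r (g B) _) ⟩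
    Σ⟨ r ⟩ (λ B → Σ⟨ r ⟩ (λ A → ⟦ φ A ⟧ * kernel c A B) * g B) ≤⟨ Σ-mono r column ⟩
    Σ⟨ r ⟩ (λ B → K * g B)                                     ≡⟨ Σ-*ˡ r K g ⟩
    K * b                                                      ∎
    where
    column : ∀ B → Σ⟨ r ⟩ (λ A → ⟦ φ A ⟧ * kernel c A B) * g B ≤ K * g B
    column B with ψ B in eq
    ... | false = ≤-reflexive (trans (*-zeroʳ (Σ⟨ r ⟩ (λ A → ⟦ φ A ⟧ * kernel c A B))) (sym (*-zeroʳ K)))
    ... | true  = *-monoˡ-≤ _ (kernel-sum c φ B (injφ eq))

  Σy≤ : Σ⟨ r ⟩ (λ A → Σ⟨ r ⟩ (y A)) ≤ K * a
  Σy≤ = begin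
    Σ⟨ r ⟩ (λ A → Σ⟨ r ⟩ (y A))                                       ≡⟨ Σ-cong r (λ A → Σ-*ʳ r (f A) _) ⟩
    Σ⟨ r ⟩ (λ A → Σ⟨ r ⟩ (λ B → ⟦ ψ B ⟧ * kernel (dual c) B A) * f A) ≤⟨ Σ-mono r row ⟩
    Σ⟨ r ⟩ (λ A → K * f A)                                            ≡⟨ Σ-*ˡ r K f ⟩
    K * a                                                             ∎
    where
    row : ∀ A → Σ⟨ r ⟩ (λ B → ⟦ ψ B ⟧ * kernel (dual c) B A) * f A ≤ K * f A
    row A with φ A in eq
    ... | false = ≤-reflexive (trans (*-zeroʳ (Σ⟨ r ⟩ (λ B → ⟦ ψ B ⟧ * kernel (dual c) B A))) (sym (*-zeroʳ K)))
    ... | true  = *-monoˡ-≤ _ (≤-trans (kernel-sum (dual c) ψ A (injψ eq)) (≤-reflexive (mass-dual c)))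

  square : (a * b) * (a * b) ≤ (a * b) * (K * K)
  square = begin
    (a * b) * (a * b)
      ≡⟨ cong₂ _*_ Σz Σz ⟨
    Σ⟨ r ⟩ (λ A → Σ⟨ r ⟩ (z A)) * Σ⟨ r ⟩ (λ A → Σ⟨ r ⟩ (z A))
      ≤⟨ cauchy-schwarz r (λ A → cauchy-schwarz r (z²≤xy A)) ⟩
    Σ⟨ r ⟩ (λ A → Σ⟨ r ⟩ (x A)) * Σ⟨ r ⟩ (λ A → Σ⟨ r ⟩ (y A))
      ≤⟨ *-mono-≤ Σx≤ Σy≤ ⟩
    (K * b) * (K * a)
      ≡⟨ regroup K a b ⟩
    (a * b) * (K * K) ∎
    where
    regroup : ∀ K a b → (K * b) * (K * a) ≡ (a * b) * (K * K)
    regroup = solve-∀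

  -- The product ab may vanish; the case split makes the cancelled factor visibly nonzero.
  cancel : ∀ s → s ≡ a * b → s ≤ K * K
  cancel zero    _  = z≤n
  cancel (suc s) eq = *-cancelˡ-≤ (suc s) (subst (λ t → t * t ≤ t * (K * K)) (sym eq) square)

-- Replacing a weighted coordinate by one of weight 1.

-- The equalising parameter is k = a₀b₀ + a₀b₁ − a₁b₀, l = a₀b₀ − a₀b₁ + a₁b₀ when both are nonnegative;
-- otherwise an endpoint (0 , 1) or (1 , 0) is enough.
free-coordinate : ∀ N a₀ a₁ b₀ b₁ → a₀ * b₀ ≤ N →
  (∀ k l → (k * a₀ + (k + l) * a₁) * (l * b₀ + (k + l) * b₁) ≤ (k + l) * (k + l) * N) →
  4 * ((a₀ + a₁) * (b₀ + b₁)) ≤ 9 * N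
free-coordinate N a₀ a₁ b₀ b₁ a₀b₀≤N h = go a₀ b₀ refl refl
  where
  open ≤-Reasoning

  -- The choice α = 0 gives a₁(b₀ + b₁) ≤ N, so the loss is only a factor 2, and 8 ≤ 9.
  edgeˡ : a₀ ≤ a₁ → 4 * ((a₀ + a₁) * (b₀ + b₁)) ≤ 9 * N
  edgeˡ a₀≤a₁ = begin
    4 * ((a₀ + a₁) * (b₀ + b₁))                        ≤⟨ *-monoʳ-≤ 4 (*-monoˡ-≤ (b₀ + b₁) (+-monoˡ-≤ a₁ a₀≤a₁)) ⟩
    4 * ((a₁ + a₁) * (b₀ + b₁))                        ≡⟨ regroup a₀ a₁ b₀ b₁ ⟩
    8 * ((0 * a₀ + 1 * a₁) * (1 * b₀ + 1 * b₁))        ≤⟨ *-monoʳ-≤ 8 (h 0 1) ⟩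
    8 * (1 * N)                                        ≡⟨ cong (8 *_) (*-identityˡ N) ⟩
    8 * N                                              ≤⟨ *-monoˡ-≤ N (n≤1+n 8) ⟩
    9 * N                                              ∎
    where
    regroup : ∀ a₀ a₁ b₀ b₁ → 4 * ((a₁ + a₁) * (b₀ + b₁)) ≡ 8 * ((0 * a₀ + 1 * a₁) * (1 * b₀ + 1 * b₁))
    regroup = solve-∀

  edgeʳ : b₀ ≤ b₁ → 4 * ((a₀ + a₁) * (b₀ + b₁)) ≤ 9 * N
  edgeʳ b₀≤b₁ = begin
    4 * ((a₀ + a₁) * (b₀ + b₁))                        ≤⟨ *-monoʳ-≤ 4 (*-monoʳ-≤ (a₀ + a₁) (+-monoˡ-≤ b₁ b₀≤b₁)) ⟩
    4 * ((a₀ + a₁) * (b₁ + b₁))                        ≡⟨ regroup a₀ a₁ b₀ b₁ ⟩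
    8 * ((1 * a₀ + 1 * a₁) * (0 * b₀ + 1 * b₁))        ≤⟨ *-monoʳ-≤ 8 (h 1 0) ⟩
    8 * (1 * N)                                        ≡⟨ cong (8 *_) (*-identityˡ N) ⟩
    8 * N                                              ≤⟨ *-monoˡ-≤ N (n≤1+n 8) ⟩
    9 * N                                              ∎
    where
    regroup : ∀ a₀ a₁ b₀ b₁ → 4 * ((a₀ + a₁) * (b₁ + b₁)) ≡ 8 * ((1 * a₀ + 1 * a₁) * (0 * b₀ + 1 * b₁))
    regroup = solve-∀

  D P Q Y : ℕ
  D = a₀ * b₀
  P = a₀ * b₁
  Q = a₁ * b₀
  Y = D + P + Q

  balanced : 0 < D → ∀ k l → Q + k ≡ D + P → P + l ≡ D + Q → 4 * ((a₀ + a₁) * (b₀ + b₁)) ≤ 9 * N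
  -- Multiplying by D turns (a₀ + a₁)(b₀ + b₁) into (D + P)(D + Q), whose factors add up to D + Y.
  -- The extra 2 makes room for 2 · 2D · Y ≤ 4D² + Y², tight when Y = 2D.
  balanced D>0 k l k-def l-def = *-cancelˡ-≤ D (*-cancelˡ-≤ 2 (begin
    2 * (D * (4 * ((a₀ + a₁) * (b₀ + b₁))))   ≡⟨ factor a₀ a₁ b₀ b₁ ⟩
    2 * (4 * ((D + P) * (D + Q)))             ≤⟨ *-monoʳ-≤ 2 (4mn≤[m+n]² (D + P) (D + Q)) ⟩
    2 * ((D + P + (D + Q)) * (D + P + (D + Q)))  ≡⟨ expand D P Q ⟩
    2 * (D * D + Y * Y) + 2 * ((2 * D) * Y)   ≤⟨ +-monoʳ-≤ (2 * (D * D + Y * Y)) (2mn≤m²+n² (2 * D) Y) ⟩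
    2 * (D * D + Y * Y) + ((2 * D) * (2 * D) + Y * Y)  ≡⟨ collect D Y ⟩
    6 * (D * D) + 3 * (Y * Y)                 ≤⟨ +-mono-≤ (*-monoʳ-≤ 6 (*-monoʳ-≤ D a₀b₀≤N)) (*-monoʳ-≤ 3 Y²≤4DN) ⟩
    6 * (D * N) + 3 * (4 * (D * N))           ≡⟨ total D N ⟩
    2 * (D * (9 * N))                         ∎))
    where
    instance
      D≢0 : NonZero D
      D≢0 = >-nonZero D>0
    factor : ∀ a₀ a₁ b₀ b₁ → 2 * (a₀ * b₀ * (4 * ((a₀ + a₁) * (b₀ + b₁)))) ≡ 2 * (4 * ((a₀ * b₀ + a₀ * b₁) * (a₀ * b₀ + a₁ * b₀)))
    factor = solve-∀
    expand : ∀ D P Q → 2 * ((D + P + (D + Q)) * (D + P + (D + Q))) ≡ 2 * (D * D + (D + P + Q) * (D + P + Q)) + 2 * ((2 * D) * (D + P + Q))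
    expand = solve-∀
    collect : ∀ D Y → 2 * (D * D + Y * Y) + ((2 * D) * (2 * D) + Y * Y) ≡ 6 * (D * D) + 3 * (Y * Y)
    collect = solve-∀
    total : ∀ D N → 6 * (D * N) + 3 * (4 * (D * N)) ≡ 2 * (D * (9 * N))
    total = solve-∀

    k+l : k + l ≡ 2 * D
    k+l = +-cancelˡ-≡ (Q + P) (k + l) (2 * D) (begin-equality
      Q + P + (k + l)      ≡⟨ interchange Q P k l ⟩
      (Q + k) + (P + l)    ≡⟨ cong₂ _+_ k-def l-def ⟩
      (D + P) + (D + Q)    ≡⟨ shuffle D P Q ⟩
      Q + P + 2 * D        ∎)
      where
      shuffle : ∀ D P Q → (D + P) + (D + Q) ≡ Q + P + 2 * D
      shuffle = solve-∀

    factorˡ : k * a₀ + (k + l) * a₁ ≡ a₀ * Y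
    factorˡ = begin-equality
      k * a₀ + (k + l) * a₁      ≡⟨ cong (λ s → k * a₀ + s * a₁) k+l ⟩
      k * a₀ + 2 * D * a₁        ≡⟨ regroup k a₀ a₁ b₀ ⟩
      a₀ * ((Q + k) + Q)         ≡⟨ cong (λ s → a₀ * (s + Q)) k-def ⟩
      a₀ * Y                     ∎
      where
      regroup : ∀ k a₀ a₁ b₀ → k * a₀ + 2 * (a₀ * b₀) * a₁ ≡ a₀ * ((a₁ * b₀ + k) + a₁ * b₀)
      regroup = solve-∀

    factorʳ : l * b₀ + (k + l) * b₁ ≡ b₀ * Y
    factorʳ = begin-equality
      l * b₀ + (k + l) * b₁      ≡⟨ cong (λ s → l * b₀ + s * b₁) k+l ⟩
      l * b₀ + 2 * D * b₁        ≡⟨ regroup l a₀ b₀ b₁ ⟩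
      b₀ * ((P + l) + P)         ≡⟨ cong (λ s → b₀ * (s + P)) l-def ⟩
      b₀ * (D + Q + P)           ≡⟨ cong (b₀ *_) (swap D P Q) ⟩
      b₀ * Y                     ∎
      where
      regroup : ∀ l a₀ b₀ b₁ → l * b₀ + 2 * (a₀ * b₀) * b₁ ≡ b₀ * ((a₀ * b₁ + l) + a₀ * b₁)
      regroup = solve-∀
      swap : ∀ D P Q → D + Q + P ≡ D + P + Q
      swap = solve-∀

    -- At this parameter the two factors are a₀Y and b₀Y, so `h` reads DY² ≤ (2D)²N.
    Y²≤4DN : Y * Y ≤ 4 * (D * N)
    Y²≤4DN = *-cancelˡ-≤ D (begin
      D * (Y * Y)                                          ≡⟨ *-interchange a₀ b₀ Y Y ⟩
      (a₀ * Y) * (b₀ * Y)                                  ≡⟨ cong₂ _*_ factorˡ factorʳ ⟨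
      (k * a₀ + (k + l) * a₁) * (l * b₀ + (k + l) * b₁)    ≤⟨ h k l ⟩
      (k + l) * (k + l) * N                                ≡⟨ cong (λ s → s * s * N) k+l ⟩
      2 * D * (2 * D) * N                                  ≡⟨ regroup D N ⟩
      D * (4 * (D * N))                                    ∎)
      where
      regroup : ∀ D N → 2 * D * (2 * D) * N ≡ D * (4 * (D * N))
      regroup = solve-∀

  go : ∀ s t → s ≡ a₀ → t ≡ b₀ → 4 * ((a₀ + a₁) * (b₀ + b₁)) ≤ 9 * N
  go zero    _       eq _   = edgeˡ (subst (_≤ a₁) eq z≤n)
  go (suc _) zero    _  eq  = edgeʳ (subst (_≤ b₁) eq z≤n)
  go (suc s) (suc t) eq eq′ with ≤-total (D + P) Q | ≤-total (D + Q) P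
  -- A nonpositive `k` forces a₀b₀ ≤ a₁b₀, and a nonpositive `l` forces a₀b₀ ≤ a₀b₁; cancelling
  -- leads to an endpoint.
  ... | inj₁ D+P≤Q | _ =
    edgeˡ (*-cancelʳ-≤ a₀ a₁ b₀ {{subst NonZero eq′ _}} (≤-trans (m≤m+n D P) D+P≤Q))
  ... | inj₂ _ | inj₁ D+Q≤P =
    edgeʳ (*-cancelˡ-≤ a₀ {{subst NonZero eq _}} (≤-trans (m≤m+n D Q) D+Q≤P))
  ... | inj₂ Q≤D+P | inj₂ P≤D+Q =
    balanced (subst₂ (λ a b → 0 < a * b) eq eq′ (s≤s z≤n))
      (D + P ∸ Q) (D + Q ∸ P) (m+[n∸m]≡n Q≤D+P) (m+[n∸m]≡n P≤D+Q)

-- Induction on the number of coordinates of weight 1.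

-- The first m coordinates carry weight 1, the last r coordinates are weighted by c.
total : ∀ {m r} → Weights r → (Subset m → Subset r → Bool) → ℕ
total {m} {r} c φ = Σ⟨ m ⟩ (λ S → Σ⟨ r ⟩ (λ A → ⟦ φ S A ⟧ * weight c A))

-- A subset of the whole ground set is a pair (S, A). Condition (i) is this property for (φ, ψ), and
-- (ii) is the same for (ψ, φ), up to commutativity of union.
LeftCancellative : ∀ {m r} → (φ ψ : Subset m → Subset r → Bool) → Set
LeftCancellative φ ψ = ∀ {S S′ T A A′ B} → φ S A ≡ true → φ S′ A′ ≡ true → ψ T B ≡ true →
  S ∪ T ≡ S′ ∪ T → A ∪ B ≡ A′ ∪ B → S ≡ S′ × A ≡ A′

shift : ∀ {m r} → (Subset (suc m) → Subset r → Bool) → Subset m → Subset (suc r) → Bool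
shift φ S (a ∷ A) = φ (a ∷ S) A

LeftCancellative-shift : ∀ {m r} {φ ψ : Subset (suc m) → Subset r → Bool} →
  LeftCancellative φ ψ → LeftCancellative (shift φ) (shift ψ)
LeftCancellative-shift canc {A = a ∷ A} {a′ ∷ A′} {b ∷ B} h h′ k eq eq′
  with canc h h′ k (cong₂ _∷_ (∷-injectiveˡ eq′) eq) (∷-injectiveʳ eq′)
... | e , refl = ∷-injectiveʳ e , cong (_∷ A) (∷-injectiveˡ e)

total-shift : ∀ {m r} k l (c : Weights r) (φ : Subset (suc m) → Subset r → Bool) →
  total ((k , l) ∷ c) (shift φ)
    ≡ k * total c (λ S → φ (outside ∷ S)) + (k + l) * total c (λ S → φ (inside ∷ S))
total-shift {m} {r} k l c φ = trans (Σ-+ m _ _) (cong₂ _+_ (pull k outside) (pull (k + l) inside))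
  where
  comm : ∀ a b d → a * (b * d) ≡ b * (a * d)
  comm = solve-∀
  pull : ∀ x a → Σ⟨ m ⟩ (λ S → Σ⟨ r ⟩ (λ A → ⟦ φ (a ∷ S) A ⟧ * (x * weight c A))) ≡ x * total c (λ S → φ (a ∷ S))
  pull x a = trans
    (Σ-cong m (λ S → trans (Σ-cong r (λ A → comm ⟦ φ (a ∷ S) A ⟧ x _)) (Σ-*ˡ r x _)))
    (Σ-*ˡ m x _)

-- The weights are arbitrary because the step moves a coordinate into the weighted block. Both
-- hypotheses of `free-coordinate` are instances of the induction hypothesis: one for the sets
-- avoiding the first point, one with that point weighted by any (k, l).
total-bound : ∀ m {r} (c : Weights r) (φ ψ : Subset m → Subset r → Bool) →
  LeftCancellative φ ψ → LeftCancellative ψ φ →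
  4 ^ m * (total c φ * total (dual c) ψ) ≤ 9 ^ m * (mass c * mass c)
total-bound zero c φ ψ cancφ cancψ = *-monoʳ-≤ 1 (weighted-bound c (φ []) (ψ [])
  (λ k h h′ eq → proj₂ (cancφ h h′ k refl eq)) (λ k h h′ eq → proj₂ (cancψ h h′ k refl eq)))
total-bound (suc m) {r} c φ ψ cancφ cancψ = begin
  4 * 4 ^ m * ((a₀ + a₁) * (b₀ + b₁))                       ≡⟨ scale (4 ^ m) a₀ a₁ b₀ b₁ ⟩
  -- The factor 4^m is absorbed into the totals of `φ` alone, so that both hypotheses have bounds in
  -- terms of the same `N`.
  4 * ((4 ^ m * a₀ + 4 ^ m * a₁) * (b₀ + b₁))               ≤⟨ free-coordinate N (4 ^ m * a₀) (4 ^ m * a₁) b₀ b₁ both-outside reweighted ⟩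
  9 * N                                                     ≡⟨ *-assoc 9 (9 ^ m) (K * K) ⟨
  9 * 9 ^ m * (K * K)                                       ∎
  where
  open ≤-Reasoning
  K = mass c
  N = 9 ^ m * (K * K)
  a₀ = total c (λ S → φ (outside ∷ S))
  a₁ = total c (λ S → φ (inside ∷ S))
  b₀ = total (dual c) (λ S → ψ (outside ∷ S))
  b₁ = total (dual c) (λ S → ψ (inside ∷ S))

  scale : ∀ x a₀ a₁ b₀ b₁ → 4 * x * ((a₀ + a₁) * (b₀ + b₁)) ≡ 4 * ((x * a₀ + x * a₁) * (b₀ + b₁))
  scale = solve-∀

  restrict : ∀ {φ ψ : Subset (suc m) → Subset r → Bool} → LeftCancellative φ ψ →
    LeftCancellative (λ S → φ (outside ∷ S)) (λ S → ψ (outside ∷ S))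
  restrict canc h h′ k eq eq′ with canc h h′ k (cong (outside ∷_) eq) eq′
  ... | e , e′ = ∷-injectiveʳ e , e′

  both-outside : 4 ^ m * a₀ * b₀ ≤ N
  both-outside = subst (_≤ N) (sym (*-assoc (4 ^ m) a₀ b₀))
    (total-bound m c _ _ (restrict {φ} {ψ} cancφ) (restrict {ψ} {φ} cancψ))

  reweighted : ∀ k l → (k * (4 ^ m * a₀) + (k + l) * (4 ^ m * a₁)) * (l * b₀ + (k + l) * b₁) ≤ (k + l) * (k + l) * N
  reweighted k l = begin
    (k * (4 ^ m * a₀) + (k + l) * (4 ^ m * a₁)) * (l * b₀ + (k + l) * b₁)
      ≡⟨ regroup (4 ^ m) k l a₀ a₁ b₀ b₁ ⟩
    4 ^ m * ((k * a₀ + (k + l) * a₁) * (l * b₀ + (l + k) * b₁))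
      ≡⟨ cong (4 ^ m *_) (cong₂ _*_ (total-shift k l c φ) (total-shift l k (dual c) ψ)) ⟨
    4 ^ m * (total ((k , l) ∷ c) (shift φ) * total (dual ((k , l) ∷ c)) (shift ψ))
      ≤⟨ total-bound m ((k , l) ∷ c) _ _ (LeftCancellative-shift {φ = φ} {ψ} cancφ) (LeftCancellative-shift {φ = ψ} {φ} cancψ) ⟩
    9 ^ m * ((k + l) * K * ((k + l) * K))
      ≡⟨ regroup′ (9 ^ m) k l K ⟩
    (k + l) * (k + l) * N ∎
    where
    regroup : ∀ x k l a₀ a₁ b₀ b₁ → (k * (x * a₀) + (k + l) * (x * a₁)) * (l * b₀ + (k + l) * b₁)
                                  ≡ x * ((k * a₀ + (k + l) * a₁) * (l * b₀ + (l + k) * b₁))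
    regroup = solve-∀
    regroup′ : ∀ y k l K → y * ((k + l) * K * ((k + l) * K)) ≡ (k + l) * (k + l) * (y * (K * K))
    regroup′ = solve-∀

-- Counting a duplicate-free list by its indicator.

Σ-mono-< : ∀ {n} {f g : Subset n → ℕ} (X : Subset n) → (∀ A → f A ≤ g A) → f X < g X → Σ⟨ n ⟩ f < Σ⟨ n ⟩ g
Σ-mono-< {zero}  []            f≤g fX<gX = fX<gX
Σ-mono-< {suc n} (outside ∷ X) f≤g fX<gX =
  +-mono-<-≤ (Σ-mono-< X (λ A → f≤g (outside ∷ A)) fX<gX) (Σ-mono n (λ A → f≤g (inside ∷ A)))
Σ-mono-< {suc n} (inside ∷ X)  f≤g fX<gX =
  +-mono-≤-< (Σ-mono n (λ A → f≤g (outside ∷ A))) (Σ-mono-< X (λ A → f≤g (inside ∷ A)) fX<gX)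

module _ {n : ℕ} where
  open import Data.List.Membership.DecPropositional (≡-dec {n = n} _≟ᵇ_) using (_∈?_)

  member : Family n → Subset n → Bool
  member 𝒜 A = does (A ∈? 𝒜)

  member⇒∈ : ∀ {𝒜 A} → member 𝒜 A ≡ true → A ∈ 𝒜
  member⇒∈ {𝒜} {A} eq with A ∈? 𝒜
  ... | yes A∈𝒜 = A∈𝒜

  ∈⇒member : ∀ {𝒜 A} → A ∈ 𝒜 → member 𝒜 A ≡ true
  ∈⇒member {𝒜} {A} = dec-true (A ∈? 𝒜)

  -- The head does not occur in the tail, so adding it raises the indicator there from 0 to 1 and
  -- the sum strictly. The factor 1 is the empty weight, which makes the sum an instance of
  -- `total []` by computation.
  length≤Σ : ∀ {𝒜} → Unique 𝒜 → length 𝒜 ≤ Σ⟨ n ⟩ (λ A → ⟦ member 𝒜 A ⟧ * 1)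
  length≤Σ [] = z≤n
  length≤Σ {X ∷ 𝒜} (X≢ ∷ uniq) = ≤-<-trans (length≤Σ uniq) (Σ-mono-< X grow new)
    where
    grow : ∀ A → ⟦ member 𝒜 A ⟧ * 1 ≤ ⟦ member (X ∷ 𝒜) A ⟧ * 1
    grow A = go (member 𝒜 A) refl
      where
      go : ∀ b → member 𝒜 A ≡ b → ⟦ b ⟧ * 1 ≤ ⟦ member (X ∷ 𝒜) A ⟧ * 1
      go false _  = z≤n
      go true  eq = ≤-reflexive
        (cong (λ b → ⟦ b ⟧ * 1) (sym (∈⇒member {X ∷ 𝒜} {A} (there (member⇒∈ eq)))))
    new : ⟦ member 𝒜 X ⟧ * 1 < ⟦ member (X ∷ 𝒜) X ⟧ * 1
    new = subst₂ (λ b b′ → ⟦ b ⟧ * 1 < ⟦ b′ ⟧ * 1)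
      (sym (dec-false (X ∈? 𝒜) (λ X∈𝒜 → All.lookup X≢ X∈𝒜 refl)))
      (sym (∈⇒member {X ∷ 𝒜} (here refl)))
      ≤-refl

-- The bound (9/4)ⁿ and its numerical consequence.

^-distribʳ-* : ∀ a b n → (a * b) ^ n ≡ a ^ n * b ^ n
^-distribʳ-* a b zero    = refl
^-distribʳ-* a b (suc n) = trans (cong (a * b *_) (^-distribʳ-* a b n)) (*-interchange a b (a ^ n) (b ^ n))

cancellative-bound : ∀ {n} {𝒜 ℬ : Family n} → Unique 𝒜 → Unique ℬ → Cancellative 𝒜 ℬ →
  4 ^ n * (length 𝒜 * length ℬ) ≤ 9 ^ n
cancellative-bound {n} {𝒜} {ℬ} uniq𝒜 uniqℬ (cancˡ , cancʳ) = begin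
  4 ^ n * (length 𝒜 * length ℬ)      ≤⟨ *-monoʳ-≤ (4 ^ n) (*-mono-≤ (length≤Σ uniq𝒜) (length≤Σ uniqℬ)) ⟩
  4 ^ n * (total [] φ * total [] ψ)  ≤⟨ total-bound n [] φ ψ canc canc′ ⟩
  9 ^ n * 1                          ≡⟨ *-identityʳ (9 ^ n) ⟩
  9 ^ n                              ∎
  where
  open ≤-Reasoning
  φ ψ : Subset n → Subset 0 → Bool
  φ S _ = member 𝒜 S
  ψ S _ = member ℬ S
  canc : LeftCancellative φ ψ
  canc {A = []} {A′ = []} h h′ k eq _ = cancˡ (member⇒∈ h) (member⇒∈ h′) (member⇒∈ k) eq , refl
  canc′ : LeftCancellative ψ φ
  canc′ {S} {S′} {T} {A = []} {A′ = []} h h′ k eq _ =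
    cancʳ (member⇒∈ k) (member⇒∈ h) (member⇒∈ h′)
      (trans (∪-comm T S) (trans eq (∪-comm S′ T))) , refl

theorem5 : (n : ℕ) (𝒜 ℬ : Family n) → Unique 𝒜 → Unique ℬ → Cancellative 𝒜 ℬ →
    length 𝒜 * length ℬ * 10000 ^ n ≤ 22682 ^ n
theorem5 n 𝒜 ℬ uniq𝒜 uniqℬ canc = *-cancelˡ-≤ (4 ^ n) {{m^n≢0 4 n}} (begin
  4 ^ n * (length 𝒜 * length ℬ * 10000 ^ n)  ≡⟨ *-assoc (4 ^ n) (length 𝒜 * length ℬ) (10000 ^ n) ⟨
  4 ^ n * (length 𝒜 * length ℬ) * 10000 ^ n  ≤⟨ *-monoˡ-≤ (10000 ^ n) (cancellative-bound uniq𝒜 uniqℬ canc) ⟩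
  9 ^ n * 10000 ^ n                          ≡⟨ ^-distribʳ-* 9 10000 n ⟨
  -- This is 9/4 ≤ 2.2682 cleared of denominators: 9 · 10000 against 4 · 22682.
  90000 ^ n                                  ≤⟨ ^-monoˡ-≤ n (≤ᵇ⇒≤ 90000 90728 _) ⟩
  90728 ^ n                                  ≡⟨ ^-distribʳ-* 4 22682 n ⟩
  4 ^ n * 22682 ^ n                          ∎)
  where open ≤-Reasoning
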